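{- Let $N\ge 1$ and let $\phi: H_0(S_N)\to M_N$ be the quotient morphism of monoids sending $\pi_i\mapsto\pi_i$, where $M_N$ is the quotient of $H_0(S_N)$ by the additional relations $\pi_i\pi_{i+1}\pi_i=\pi_i\pi_{i+1}$ for $1\le i\le N-2$. For every $m\in M_N$, consider the fiber $F_m=\{w\in S_N:\ \phi(\pi_w)=m\}$. Every nonempty fiber $F_m$ contains a unique $[321]$-avoiding permutation, and it is of minimal length among the elements of $F_m$; and $F_m$ contains a unique $[231]$-avoiding permutation, and it is of maximal length among the elements of $F_m$.
   Context: $S_N$ is the symmetric group generated by the simple transpositions $s_1,\dots,s_{N-1}$. Permutations are written in one-line notation $x=[x(1),\dots,x(N)]$ and composed as functions, $(uv)(j)=u(v(j))$, so $xs_i$ is obtained from $x$ by swapping the entries in positions $i,i+1$. The length $\operatorname{len}(x)$ is the length of a reduced (minimal-length) word for $x$ in the $s_i$, i.e. the number of inversions. The $0$-Hecke monoid $H_0(S_N)$ is generated by $\pi_1,\dots,\pi_{N-1}$ with relations $\pi_i^2=\pi_i$, $\pi_i\pi_j=\pi_j\pi_i$ for $|i-j|\ge2$, $\pi_i\pi_{i+1}\pi_i=\pi_{i+1}\pi_i\pi_{i+1}$; its elements are $\pi_w:=\pi_{i_1}\cdots\pi_{i_k}$ for $w\in S_N$, where $w=s_{i_1}\cdots s_{i_k}$ is any reduced word, and $w\mapsto \pi_w$ is a bijection. A permutation $x$ contains a pattern $\sigma\in S_k$ if some subsequence $x(i_1),\dots,x(i_k)$ with $i_1<\dots<i_k$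 is in the same relative order as $\sigma(1),\dots,\sigma(k)$; otherwise $x$ avoids $\sigma$. The monoid $M_N$ is isomorphic to the monoid $\operatorname{NDPF}_N$ of order-preserving, regressive ($f(x)\le x$) maps of $\{1,\dots,N\}$, with $\pi_i$ the map sending $i+1\mapsto i$ and fixing all other points. -}

module Defs where

open import Level using (Level; _⊔_; 0ℓ)
open import Algebra.Bundles using (Monoid)
open import Algebra.Morphism.Structures using (module MonoidMorphisms)
open import Data.Nat using (ℕ; zero; suc; pred; _≤_; _<_; ∣_-_∣)
open import Data.Nat.Properties using (≮⇒≥)
open import Data.Nat.Induction using (<-wellFounded)
open import Data.Fin using (Fin; zero; suc; toℕ; inject₁)
import Data.Fin as Fin
import Data.Fin.Properties as Fin
open import Data.Fin.Patterns using (0F; 1F; 2F)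
open import Data.Fin.Permutation
  using (Permutation′; permutation; _⟨$⟩ʳ_; _⟨$⟩ˡ_; _≈_; id; flip; _∘ₚ_;
         transpose; lift₀; remove; inverseˡ; inverseʳ;
         lift₀-cong; lift₀-comp; lift₀-remove; lift₀-transpose)
open import Data.List using (List; []; _∷_; _++_; map; length)
open import Data.List.Properties using (++-monoid)
open import Data.Product using (_×_; _,_; proj₁; proj₂; ∃-syntax; Σ-syntax)
open import Function.Bundles using (_⇔_)
open import Induction.WellFounded using (Acc; acc)
open import Relation.Binary.Core using (Rel)
open import Relation.Binary.PropositionalEquality
  using (_≡_; refl; sym; trans; cong; subst)
open import Relation.Nullary using (¬_; Dec; yes; no)
open import Relation.Nullary.Decidable using (map′)
open import Relation.Unary using (Pred; Decidable)

-- The quotient of a monoid by the smallest congruence containing R has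
-- the same carrier as the monoid, with a coarser equality.

module _ {c ℓ r : Level} (A : Monoid c ℓ)
         (R : Rel (Monoid.Carrier A) r) where

  private module A = Monoid A

  data Congruence : Rel A.Carrier (c ⊔ ℓ ⊔ r) where
    base    : ∀ {x y} → x A.≈ y → Congruence x y
    rel     : ∀ {x y} → R x y → Congruence x y
    symm    : ∀ {x y} → Congruence x y → Congruence y x
    transi  : ∀ {x y z} → Congruence x y → Congruence y z → Congruence x z
    ∙-congr : ∀ {x y u v} → Congruence x y → Congruence u v →
              Congruence (x A.∙ u) (y A.∙ v)

  Quotient : Monoid c (c ⊔ ℓ ⊔ r)
  Quotient = record
    { Carrier  = A.Carrier
    ; _≈_      = Congruence
    ; _∙_      = A._∙_
    ; ε        = A.ε
    ; isMonoid = record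
      { isSemigroup = record
        { isMagma = record
          { isEquivalence = record
            { refl  = base A.refl
            ; sym   = symm
            ; trans = transi
            }
          ; ∙-cong = ∙-congr
          }
        ; assoc = λ x y z → base (A.assoc x y z)
        }
      ; identity = (λ x → base (A.identityˡ x)) , (λ x → base (A.identityʳ x))
      }
    }

  quotientMap : A.Carrier → Monoid.Carrier Quotient
  quotientMap x = x

  quotientMap-isMonoidHomomorphism :
    MonoidMorphisms.IsMonoidHomomorphism
      A.rawMonoid (Monoid.rawMonoid Quotient) quotientMap
  quotientMap-isMonoidHomomorphism = record
    { isMagmaHomomorphism = record
      { isRelHomomorphism = record { cong = base }
      ; homo              = λ _ _ → base A.refl
      }
    ; ε-homo = base A.refl
    }

-- Everything is 0-based: S_N acts on Fin N = {0,…,N-1}, and the k-th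
-- element of Gen N, counting from 0, indexes s_{k+1} and π_{k+1}.

Gen : ℕ → Set
Gen N = Fin (pred N)

s : ∀ {N} → Gen N → Permutation′ N
s {suc n} i = transpose (inject₁ i) (suc i)

infixr 9 _·_

-- (u · v)(j) = u(v(j)); the library's _∘ₚ_ composes in the other order.
_·_ : ∀ {N} → Permutation′ N → Permutation′ N → Permutation′ N
u · v = v ∘ₚ u

eval : ∀ {N} → List (Gen N) → Permutation′ N
eval []       = id
eval (i ∷ is) = s i · eval is

IsReducedWord : ∀ {N} → Permutation′ N → List (Gen N) → Set
IsReducedWord x is =
  eval is ≈ x × (∀ js → eval js ≈ x → length is ≤ length js)

-- Every permutation has a word, by induction on N: multiply by a cycle to fix
-- the first point.  A finite search among shorter words then gives a reduced
-- word (hasReducedWord).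
eval-++ : ∀ {N} (is js : List (Gen N)) →
          eval {N} (is ++ js) ≈ eval is · eval js
eval-++     []       js k = refl
eval-++ {N} (i ∷ is) js k = cong (s {N} i ⟨$⟩ʳ_) (eval-++ {N} is js k)

eval-map-suc : ∀ {n} (is : List (Gen (suc n))) →
               eval {suc (suc n)} (map suc is) ≈ lift₀ (eval is)
eval-map-suc []       0F      = refl
eval-map-suc []       (suc k) = refl
eval-map-suc (i ∷ is) k =
  trans (cong (s {suc (suc _)} (suc i) ⟨$⟩ʳ_) (eval-map-suc is k))
    (trans (lift₀-transpose (inject₁ i) (suc i) (lift₀ (eval {suc _} is) ⟨$⟩ʳ k))
           (lift₀-comp (eval is) (s {suc _} i) k))

-- The word s_k ⋯ s_2 s_1, a cycle sending the first point to the given one.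
cycle : ∀ {n} → Fin (suc n) → List (Gen (suc n))
cycle         zero    = []
cycle {suc n} (suc k) = map suc (cycle k) ++ 0F ∷ []

cycle-0 : ∀ {n} (k : Fin (suc n)) → eval {suc n} (cycle k) ⟨$⟩ʳ 0F ≡ k
cycle-0         zero    = refl
cycle-0 {suc n} (suc k) =
  trans (eval-++ {suc (suc n)} (map suc (cycle k)) (0F ∷ []) 0F)
    (trans (eval-map-suc (cycle k) 1F) (cong suc (cycle-0 k)))

word-step : ∀ {n} → (∀ (y : Permutation′ (suc n)) → ∃[ is ] eval is ≈ y) →
            (x : Permutation′ (suc (suc n))) → ∃[ is ] eval is ≈ x
word-step {n} ih x = cycle (x ⟨$⟩ʳ 0F) ++ map suc js , correct
  where
  c = eval (cycle (x ⟨$⟩ʳ 0F))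

  y : Permutation′ (suc (suc n))
  y = flip c · x

  y-fixes-0 : y ⟨$⟩ʳ 0F ≡ 0F
  y-fixes-0 = trans (cong (c ⟨$⟩ˡ_) (sym (cycle-0 (x ⟨$⟩ʳ 0F)))) (inverseˡ c)

  js = proj₁ (ih (remove 0F y))

  js-correct : eval {suc (suc n)} (map suc js) ≈ y
  js-correct k = trans (eval-map-suc js k)
    (trans (lift₀-cong (eval js) (remove 0F y) (proj₂ (ih (remove 0F y))) k)
           (lift₀-remove y y-fixes-0 k))

  correct : eval (cycle (x ⟨$⟩ʳ 0F) ++ map suc js) ≈ x
  correct k = trans (eval-++ {suc (suc n)} (cycle (x ⟨$⟩ʳ 0F)) (map suc js) k)
    (trans (cong (c ⟨$⟩ʳ_) (js-correct k)) (inverseʳ c))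

word : ∀ {N} (x : Permutation′ N) → ∃[ is ] eval is ≈ x
word {zero}        x = [] , λ ()
word {suc zero}    x = [] , λ { 0F → fin1 (x ⟨$⟩ʳ 0F) }
  where
  fin1 : (k : Fin 1) → 0F ≡ k
  fin1 0F = refl
word {suc (suc n)} x = word-step word x

ofLength? : ∀ {n ℓ} {P : Pred (List (Fin n)) ℓ} → Decidable P →
            ∀ k → Dec (∃[ is ] length is ≡ k × P is)
ofLength? P? zero =
  map′ (λ p → [] , refl , p) (λ { ([] , refl , p) → p }) (P? [])
ofLength? P? (suc k) =
  map′ (λ { (i , is , refl , p) → i ∷ is , refl , p })
       (λ { (i ∷ is , refl , p) → i , is , refl , p })
       (Fin.any? (λ i → ofLength? (λ is → P? (i ∷ is)) k))

shorter? : ∀ {n ℓ} {P : Pred (List (Fin n)) ℓ} → Decidable P →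
           ∀ k → Dec (∃[ is ] length is < k × P is)
shorter? P? k =
  map′ (λ { (l , is , eq , p) → is , subst (_< k) (sym eq) (Fin.toℕ<n l) , p })
       (λ { (is , l<k , p) → Fin.fromℕ< l<k , is , sym (Fin.toℕ-fromℕ< l<k) , p })
       (Fin.any? {n = k} (λ l → ofLength? P? (toℕ l)))

shortest : ∀ {n ℓ} {P : Pred (List (Fin n)) ℓ} → Decidable P →
           ∀ is → Acc _<_ (length is) → P is →
           ∃[ js ] P js × (∀ ks → P ks → length js ≤ length ks)
shortest P? is (acc rs) p with shorter? P? (length is)
... | yes (js , lt , q) = shortest P? js (rs lt) q
... | no  none          = is , p , λ ks q → ≮⇒≥ (λ lt → none (ks , lt , q))

evalsTo? : ∀ {N} (x : Permutation′ N) → Decidable (λ is → eval is ≈ x)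
evalsTo? x is = Fin.all? (λ k → (eval is ⟨$⟩ʳ k) Fin.≟ (x ⟨$⟩ʳ k))

hasReducedWord : ∀ {N} (x : Permutation′ N) → ∃[ is ] IsReducedWord x is
hasReducedWord x =
  shortest (evalsTo? x) (proj₁ (word x)) (<-wellFounded _) (proj₂ (word x))

reducedWord : ∀ {N} → Permutation′ N → List (Gen N)
reducedWord x = proj₁ (hasReducedWord x)

reducedWord-isReduced : ∀ {N} (x : Permutation′ N) →
                        IsReducedWord x (reducedWord x)
reducedWord-isReduced x = proj₂ (hasReducedWord x)

len : ∀ {N} → Permutation′ N → ℕ
len x = length (reducedWord x)

-- Lists under concatenation are the free monoid, so a word i₁ ∷ ⋯ ∷ iₖ ∷ []
-- stands for the product π_{i₁} ⋯ π_{iₖ}.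

data HeckeRelation {N : ℕ} : Rel (List (Gen N)) 0ℓ where
  idem  : ∀ i → HeckeRelation (i ∷ i ∷ []) (i ∷ [])
  comm  : ∀ i j → 2 ≤ ∣ toℕ i - toℕ j ∣ →
          HeckeRelation (i ∷ j ∷ []) (j ∷ i ∷ [])
  braid : ∀ i j → toℕ j ≡ suc (toℕ i) →
          HeckeRelation (i ∷ j ∷ i ∷ []) (j ∷ i ∷ j ∷ [])

H₀ : ℕ → Monoid 0ℓ 0ℓ
H₀ N = Quotient (++-monoid (Gen N)) (HeckeRelation {N})

data NDPFRelation {N : ℕ} : Rel (Monoid.Carrier (H₀ N)) 0ℓ where
  absorb : ∀ i j → toℕ j ≡ suc (toℕ i) →
           NDPFRelation (i ∷ j ∷ i ∷ []) (i ∷ j ∷ [])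

M : ℕ → Monoid 0ℓ 0ℓ
M N = Quotient (H₀ N) (NDPFRelation {N})

φ : ∀ N → Monoid.Carrier (H₀ N) → Monoid.Carrier (M N)
φ N = quotientMap (H₀ N) (NDPFRelation {N})

-- The class of π_w in H₀ does not depend on which reduced word of w is used
-- (Matsumoto), so the choice made by reducedWord is immaterial.
π[_] : ∀ {N} → Permutation′ N → Monoid.Carrier (H₀ N)
π[ w ] = reducedWord w

Fiber : ∀ N → Monoid.Carrier (M N) → Pred (Permutation′ N) 0ℓ
Fiber N m w = φ N π[ w ] ≈ₘ m
  where open Monoid (M N) using () renaming (_≈_ to _≈ₘ_)

Contains : ∀ {N k} → Permutation′ N → Permutation′ k → Set
Contains {N} {k} x σ =
  Σ[ p ∈ (Fin k → Fin N) ]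
    (∀ (a b : Fin k) → a Fin.< b → p a Fin.< p b) ×
    (∀ (a b : Fin k) →
       (x ⟨$⟩ʳ p a) Fin.< (x ⟨$⟩ʳ p b) ⇔ (σ ⟨$⟩ʳ a) Fin.< (σ ⟨$⟩ʳ b))

Avoids : ∀ {N k} → Permutation′ N → Permutation′ k → Set
Avoids x σ = ¬ Contains x σ

[321] : Permutation′ 3
[321] = permutation
  (λ { 0F → 2F ; 1F → 1F ; 2F → 0F })
  (λ { 0F → 2F ; 1F → 1F ; 2F → 0F })
  (λ { 0F → refl ; 1F → refl ; 2F → refl })
  (λ { 0F → refl ; 1F → refl ; 2F → refl })

[231] : Permutation′ 3
[231] = permutation
  (λ { 0F → 1F ; 1F → 2F ; 2F → 0F })
  (λ { 0F → 2F ; 1F → 0F ; 2F → 1F })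
  (λ { 0F → refl ; 1F → refl ; 2F → refl })
  (λ { 0F → refl ; 1F → refl ; 2F → refl })

{-# OPTIONS --safe #-}

-- Words act on ℕ as order-preserving regressive functions, π_i merging
-- i+1 into i.  Pushing the points 0, 1, 2, … down one after the other gives a
-- normal form, so two words are equal in M exactly when they act equally.  A
-- reduced word of w acts by j ↦ min { w(k) : k ≥ j }, hence the fibers are the
-- classes of permutations with the same suffix minima.  If w has a 321 or 231
-- pattern at positions a < b < c, swapping the entries at a and b keeps the
-- suffix minima and, by the exchange property, shortens (321) or lengthens
-- (231) w.  Conversely the suffix minima determine a 321-avoiding permutation
-- from the left and a 231-avoiding one from the right.  So repeated swapping
-- leads from all elements of a fiber to the same one, which is extremal.
module Submission where

open import Defs
open import Level using (0ℓ)
open import Algebra.Bundles using (Monoid)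
open import Data.Nat
  using (ℕ; zero; suc; _+_; _*_; _∸_; _≤_; _<_; _≥_; _≟_; _<?_; z≤n; s≤s; ∣_-_∣)
open import Data.Nat.Properties
  using (≤-refl; ≤-reflexive; ≤-trans; ≤-antisym; <-trans; ≤-<-trans; <-≤-trans; <⇒≤; <⇒≢;
         ≤∧≢⇒<; <-irrefl; <-cmp; n≤1+n; m<n⇒m<1+n; m<1+n⇒m≤n; m≤n⇒m≤1+n; m≤n⇒m<n∨m≡n; ≤-pred;
         +-suc; +-comm; +-identityʳ; +-mono-≤; +-monoʳ-≤; *-monoʳ-≤; n∸n≡0; m+[n∸m]≡n; +-∸-assoc;
         ∸-monoʳ-<; ∸-cancelʳ-≤; module ≤-Reasoning)
open import Data.Nat.Induction using (<-wellFounded)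
open import Data.Fin using (Fin; zero; suc; toℕ; inject₁; fromℕ<)
import Data.Fin as Fin
import Data.Fin.Properties as Fin
import Data.Fin.Induction as Fin
open import Data.Fin.Patterns using (0F; 1F; 2F)
open import Data.Fin.Permutation
  using (Permutation′; _≈_; _⟨$⟩ʳ_; _⟨$⟩ˡ_; inverseˡ; inverseʳ; transpose; flip; remove)
open import Data.List using (List; []; _∷_; _++_; length; map)
open import Data.List.Properties using (length-++; length-map)
open import Data.Product using (_×_; _,_; proj₁; proj₂; ∃; ∃!; ∃-syntax)
open import Data.Sum using (_⊎_; inj₁; inj₂)
open import Function using (_∘_; Equivalence; mk⇔)
open import Induction.WellFounded using (Acc; acc)
open import Relation.Binary using (tri<; tri≈; tri>)
open import Relation.Binary.PropositionalEquality
  using (_≡_; _≢_; refl; sym; trans; cong; cong₂; subst; subst₂)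
open import Relation.Nullary using (¬_; Dec; yes; no; contradiction)
open import Relation.Nullary.Decidable using (_×-dec_; dec-true; dec-false)
open import Relation.Unary using (Pred; Decidable)
import Relation.Binary.Reasoning.Setoid as SetoidReasoning

-- Order-preserving regressive functions

-- Taking all of ℕ as domain spares range conditions in the relations below.
merge : ℕ → ℕ → ℕ
merge i x with x ≟ suc i
... | yes _ = i
... | no _  = x

merge-suc : ∀ i → merge i (suc i) ≡ i
merge-suc i with suc i ≟ suc i
... | yes _ = refl
... | no ¬p = contradiction refl ¬p

merge-≢ : ∀ {i x} → x ≢ suc i → merge i x ≡ x
merge-≢ {i} {x} x≢ with x ≟ suc i
... | yes x≡ = contradiction x≡ x≢
... | no _   = refl

merge-≤ : ∀ i x → merge i x ≤ x
merge-≤ i x with x ≟ suc i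
... | yes refl = n≤1+n i
... | no _     = ≤-refl

merge-mono : ∀ i {x y} → x ≤ y → merge i x ≤ merge i y
merge-mono i {x} {y} x≤y with x ≟ suc i | y ≟ suc i
... | yes refl | yes refl = ≤-refl
... | yes refl | no _     = <⇒≤ x≤y
... | no x≢    | yes refl = m<1+n⇒m≤n (≤∧≢⇒< x≤y x≢)
... | no _     | no _     = x≤y

merge-idem : ∀ i x → merge i (merge i x) ≡ merge i x
merge-idem i x with x ≟ suc i
... | yes _ = merge-≢ (<⇒≢ ≤-refl)
... | no x≢ = merge-≢ x≢

merge-image : ∀ i x → merge i x ≢ suc i
merge-image i x eq with x ≟ suc i
... | yes _ = <⇒≢ ≤-refl eq
... | no x≢ = x≢ eq

merge-absorbˡ : ∀ i x → merge i (merge (suc i) (merge i x)) ≡ merge i (merge (suc i) x)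
merge-absorbˡ i x with x ≟ suc i
... | no _     = refl
... | yes refl = trans (cong (merge i) (merge-≢ {suc i} {i} (<⇒≢ (m<n⇒m<1+n ≤-refl))))
  (trans (merge-≢ {i} {i} (<⇒≢ ≤-refl))
    (sym (trans (cong (merge i) (merge-≢ {suc i} {suc i} (<⇒≢ ≤-refl))) (merge-suc i))))

-- `merge (suc i)` misses the value i + 2 and `merge i` cannot create it, so the outer merging acts
-- trivially.
merge-absorbʳ : ∀ i x → merge (suc i) (merge i (merge (suc i) x)) ≡ merge i (merge (suc i) x)
merge-absorbʳ i x = merge-≢ image≢
  where
  image≢ : merge i (merge (suc i) x) ≢ suc (suc i)
  image≢ eq with merge (suc i) x ≟ suc i
  ... | yes _ = <⇒≢ (m<n⇒m<1+n ≤-refl) eq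
  ... | no _  = merge-image (suc i) x eq

merge-comm : ∀ {i j} → suc i < j → ∀ x → merge i (merge j x) ≡ merge j (merge i x)
merge-comm {i} {j} i+1<j x with x ≟ suc j
... | yes refl = trans (merge-≢ (λ eq → <⇒≢ i+1<j (sym eq)))
  (sym (trans (cong (merge j) (merge-≢ (λ eq → <⇒≢ (m<n⇒m<1+n i+1<j) (sym eq)))) (merge-suc j)))
... | no x≢ = sym (merge-≢ image≢)
  where
  image≢ : merge i x ≢ suc j
  image≢ eq with x ≟ suc i
  ... | yes _ = <⇒≢ (<-trans ≤-refl (m<n⇒m<1+n i+1<j)) eq
  ... | no _  = x≢ eq

-- Normal forms in a monoid generated by mergings

module NormalForm {c ℓ} (A : Monoid c ℓ) where

  open Monoid A
    using (Carrier; _∙_; ε; setoid; assoc; identityˡ; identityʳ; ∙-congˡ; ∙-congʳ; reflexive)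
    renaming (_≈_ to _≋_; refl to ≋-refl; sym to ≋-sym; trans to ≋-trans)
  open SetoidReasoning setoid

  -- `absorbˡ` is the relation that defines M; `absorbʳ` follows from it by the braid relation.
  module Merging (p : ℕ → Carrier)
    (p-idem  : ∀ i → p i ∙ p i ≋ p i)
    (p-comm  : ∀ {i j} → suc i < j → p i ∙ p j ≋ p j ∙ p i)
    (absorbˡ : ∀ i → p i ∙ (p (suc i) ∙ p i) ≋ p i ∙ p (suc i))
    (absorbʳ : ∀ i → p (suc i) ∙ (p i ∙ p (suc i)) ≋ p i ∙ p (suc i))
    where

    -- The product p k ⋯ p (k + d - 1), which as a function collapses the interval from k to k + d
    -- onto k.
    run : ℕ → ℕ → Carrier
    run k zero    = ε
    run k (suc d) = p k ∙ run (suc k) d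

    run-comm : ∀ {i k} d → suc i < k → p i ∙ run k d ≋ run k d ∙ p i
    run-comm         zero    i+1<k = ≋-trans (identityʳ _) (≋-sym (identityˡ _))
    run-comm {i} {k} (suc d) i+1<k = begin
      p i ∙ (p k ∙ run (suc k) d)  ≈⟨ assoc _ _ _ ⟨
      (p i ∙ p k) ∙ run (suc k) d  ≈⟨ ∙-congʳ (p-comm i+1<k) ⟩
      (p k ∙ p i) ∙ run (suc k) d  ≈⟨ assoc _ _ _ ⟩
      p k ∙ (p i ∙ run (suc k) d)  ≈⟨ ∙-congˡ (run-comm d (m≤n⇒m≤1+n i+1<k)) ⟩
      p k ∙ (run (suc k) d ∙ p i)  ≈⟨ assoc _ _ _ ⟨
      (p k ∙ run (suc k) d) ∙ p i  ∎

    -- All indices in `r` are at least i + 2, so the trailing `p i` commutes back to `p (suc i)`,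
    -- where `absorbˡ` removes it.
    run-absorbʳ : ∀ i d → run i (suc d) ∙ p i ≋ run i (suc d)
    run-absorbʳ i zero = begin
      (p i ∙ ε) ∙ p i  ≈⟨ ∙-congʳ (identityʳ _) ⟩
      p i ∙ p i        ≈⟨ p-idem i ⟩
      p i              ≈⟨ identityʳ _ ⟨
      p i ∙ ε          ∎
    run-absorbʳ i (suc d) = begin
      (p i ∙ (p (suc i) ∙ r)) ∙ p i  ≈⟨ assoc _ _ _ ⟩
      p i ∙ ((p (suc i) ∙ r) ∙ p i)  ≈⟨ ∙-congˡ (assoc _ _ _) ⟩
      p i ∙ (p (suc i) ∙ (r ∙ p i))  ≈⟨ ∙-congˡ (∙-congˡ (run-comm d ≤-refl)) ⟨
      p i ∙ (p (suc i) ∙ (p i ∙ r))  ≈⟨ ∙-congˡ (assoc _ _ _) ⟨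
      p i ∙ ((p (suc i) ∙ p i) ∙ r)  ≈⟨ assoc _ _ _ ⟨
      (p i ∙ (p (suc i) ∙ p i)) ∙ r  ≈⟨ ∙-congʳ (absorbˡ i) ⟩
      (p i ∙ p (suc i)) ∙ r          ≈⟨ assoc _ _ _ ⟩
      p i ∙ (p (suc i) ∙ r)          ∎
      where r = run (suc (suc i)) d

    run-absorbˡ : ∀ {i k} d → k ≤ i → i < k + d → p i ∙ run k d ≋ run k d
    run-absorbˡ {i} {k} zero k≤i i<k =
      contradiction (≤-<-trans k≤i (subst (i <_) (+-identityʳ k) i<k)) (<-irrefl refl)
    run-absorbˡ {i} {k} (suc d) k≤i i<k+d with m≤n⇒m<n∨m≡n k≤i
    ... | inj₂ refl = begin
      p i ∙ (p i ∙ run (suc i) d)  ≈⟨ assoc _ _ _ ⟨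
      (p i ∙ p i) ∙ run (suc i) d  ≈⟨ ∙-congʳ (p-idem i) ⟩
      p i ∙ run (suc i) d          ∎
    ... | inj₁ k<i with run-absorbˡ d k<i (subst (i <_) (+-suc k d) i<k+d) | m≤n⇒m<n∨m≡n k<i
    ...   | ih | inj₁ k+1<i = begin
      p i ∙ (p k ∙ run (suc k) d)  ≈⟨ assoc _ _ _ ⟨
      (p i ∙ p k) ∙ run (suc k) d  ≈⟨ ∙-congʳ (p-comm k+1<i) ⟨
      (p k ∙ p i) ∙ run (suc k) d  ≈⟨ assoc _ _ _ ⟩
      p k ∙ (p i ∙ run (suc k) d)  ≈⟨ ∙-congˡ ih ⟩
      p k ∙ run (suc k) d          ∎
    ...   | ih | inj₂ refl = begin
      -- Here i = k + 1. The induction hypothesis is used backwards to insert a second `p i`, which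
      -- makes `absorbʳ` applicable.
      p i ∙ (p k ∙ run i d)          ≈⟨ ∙-congˡ (∙-congˡ ih) ⟨
      p i ∙ (p k ∙ (p i ∙ run i d))  ≈⟨ ∙-congˡ (assoc _ _ _) ⟨
      p i ∙ ((p k ∙ p i) ∙ run i d)  ≈⟨ assoc _ _ _ ⟨
      (p i ∙ (p k ∙ p i)) ∙ run i d  ≈⟨ ∙-congʳ (absorbʳ k) ⟩
      (p k ∙ p i) ∙ run i d          ≈⟨ assoc _ _ _ ⟩
      p k ∙ (p i ∙ run i d)          ≈⟨ ∙-congˡ ih ⟩
      p k ∙ run i d                  ∎

    -- The factor for n moves the point n down to f n, after the points below n
    -- have reached their values.
    nf : (ℕ → ℕ) → ℕ → Carrier
    nf f zero    = ε
    nf f (suc n) = run (f n) (n ∸ f n) ∙ nf f n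

    nf-cong : ∀ {f g} n → (∀ j → j < n → f j ≡ g j) → nf f n ≡ nf g n
    nf-cong zero    f≗g = refl
    nf-cong (suc n) f≗g =
      cong₂ _∙_ (cong (λ k → run k (n ∸ k)) (f≗g n ≤-refl))
                (nf-cong n (λ j j<n → f≗g j (m≤n⇒m≤1+n j<n)))

    nf-id : ∀ n → nf (λ x → x) n ≋ ε
    nf-id zero    = ≋-refl
    nf-id (suc n) = begin
      run n (n ∸ n) ∙ nf (λ x → x) n  ≡⟨ cong (λ d → run n d ∙ nf (λ x → x) n) (n∸n≡0 n) ⟩
      ε ∙ nf (λ x → x) n              ≈⟨ identityˡ _ ⟩
      nf (λ x → x) n                  ≈⟨ nf-id n ⟩
      ε                               ∎

    -- The new letter meets the top factor, which brings n to f n: it commutes with it if f n > i +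
    -- 1, lengthens it by one letter if f n = i + 1, and is swallowed by it if f n ≤ i.
    nf-merge : ∀ {f} → (∀ {x y} → x ≤ y → f x ≤ f y) → (∀ x → f x ≤ x) →
               ∀ {i} n → suc i < n → p i ∙ nf f n ≋ nf (merge i ∘ f) n
    nf-merge {f} mono regr {i} (suc n) (s≤s i<n) with <-cmp (suc i) (f n)
    ... | tri< i+1<fn _ _ = begin
      p i ∙ (r ∙ nf f n)             ≈⟨ assoc _ _ _ ⟨
      (p i ∙ r) ∙ nf f n             ≈⟨ ∙-congʳ (run-comm (n ∸ f n) i+1<fn) ⟩
      (r ∙ p i) ∙ nf f n             ≈⟨ assoc _ _ _ ⟩
      r ∙ (p i ∙ nf f n)             ≈⟨ ∙-congˡ (nf-merge mono regr n (<-≤-trans i+1<fn (regr n))) ⟩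
      r ∙ nf (merge i ∘ f) n
        ≡⟨ cong (λ k → run k (n ∸ k) ∙ nf (merge i ∘ f) n) (merge-≢ (λ eq → <⇒≢ i+1<fn (sym eq))) ⟨
      nf (merge i ∘ f) (suc n)       ∎
      where r = run (f n) (n ∸ f n)
    ... | tri≈ _ i+1≡fn _ = begin
      p i ∙ (run (f n) (n ∸ f n) ∙ nf f n)
        ≡⟨ cong (λ k → p i ∙ (run k (n ∸ k) ∙ nf f n)) i+1≡fn ⟨
      p i ∙ (run (suc i) d ∙ nf f n)   ≈⟨ assoc _ _ _ ⟨
      run i (suc d) ∙ nf f n           ≈⟨ rest (m≤n⇒m<n∨m≡n i<n) ⟩
      run i (suc d) ∙ nf (merge i ∘ f) n
        ≡⟨ cong (λ e → run i e ∙ nf (merge i ∘ f) n) (+-∸-assoc 1 i<n) ⟨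
      run i (n ∸ i) ∙ nf (merge i ∘ f) n
        ≡⟨ cong (λ k → run k (n ∸ k) ∙ nf (merge i ∘ f) n)
             (trans (cong (merge i) (sym i+1≡fn)) (merge-suc i)) ⟨
      nf (merge i ∘ f) (suc n)       ∎
      where
      d = n ∸ suc i
      rest : suc i < n ⊎ suc i ≡ n →
             run i (suc d) ∙ nf f n ≋ run i (suc d) ∙ nf (merge i ∘ f) n
      -- For j < n, f j ≤ j < n = i + 1, so merging changes none of the lower values.
      rest (inj₂ refl) = ∙-congˡ (reflexive (nf-cong n λ j j<n →
        sym (merge-≢ (<⇒≢ (≤-<-trans (regr j) j<n)))))
      -- The lengthened run absorbs `p i` on its right, so a copy of `p i` can be split off to act
      -- on the lower factors.
      rest (inj₁ i+1<n) = begin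
        run i (suc d) ∙ nf f n          ≈⟨ ∙-congʳ (run-absorbʳ i d) ⟨
        (run i (suc d) ∙ p i) ∙ nf f n  ≈⟨ assoc _ _ _ ⟩
        run i (suc d) ∙ (p i ∙ nf f n)  ≈⟨ ∙-congˡ (nf-merge mono regr n i+1<n) ⟩
        run i (suc d) ∙ nf (merge i ∘ f) n  ∎
    ... | tri> _ _ fn<i+1 = begin
      p i ∙ (r ∙ nf f n)             ≈⟨ assoc _ _ _ ⟨
      (p i ∙ r) ∙ nf f n
        ≈⟨ ∙-congʳ (run-absorbˡ (n ∸ f n) (m<1+n⇒m≤n fn<i+1)
             (subst (i <_) (sym (m+[n∸m]≡n (regr n))) i<n)) ⟩
      nf f (suc n)
        -- By monotonicity f j ≤ f n ≤ i for all j ≤ n, so merging changes no value.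
        ≡⟨ nf-cong (suc n) (λ j j<1+n → sym (merge-≢ (<⇒≢ (≤-<-trans (mono (m<1+n⇒m≤n j<1+n)) fn<i+1)))) ⟩
      nf (merge i ∘ f) (suc n)       ∎
      where r = run (f n) (n ∸ f n)

-- Words acting as functions

act : ∀ {n} → List (Fin n) → ℕ → ℕ
act []       x = x
act (i ∷ is) x = merge (toℕ i) (act is x)

act-++ : ∀ {n} (is js : List (Fin n)) x → act (is ++ js) x ≡ act is (act js x)
act-++ []       js x = refl
act-++ (i ∷ is) js x = cong (merge (toℕ i)) (act-++ is js x)

act-mono : ∀ {n} (is : List (Fin n)) {x y} → x ≤ y → act is x ≤ act is y
act-mono []       x≤y = x≤y
act-mono (i ∷ is) x≤y = merge-mono (toℕ i) (act-mono is x≤y)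

act-≤ : ∀ {n} (is : List (Fin n)) x → act is x ≤ x
act-≤ []       x = ≤-refl
act-≤ (i ∷ is) x = ≤-trans (merge-≤ (toℕ i) _) (act-≤ is x)

far⇒apart : ∀ i j → 2 ≤ ∣ i - j ∣ → suc i < j ⊎ suc j < i
far⇒apart zero    j       2≤ = inj₁ 2≤
far⇒apart (suc i) zero    2≤ = inj₂ 2≤
far⇒apart (suc i) (suc j) 2≤ with far⇒apart i j 2≤
... | inj₁ i+1<j = inj₁ (s≤s i+1<j)
... | inj₂ j+1<i = inj₂ (s≤s j+1<i)

apart⇒far : ∀ {i j} → suc i < j → 2 ≤ ∣ i - j ∣
apart⇒far {zero}  {suc j} i+1<j       = i+1<j
apart⇒far {suc i} {suc j} (s≤s i+1<j) = apart⇒far i+1<j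

module _ {n : ℕ} where

  open Monoid (M (suc n)) using ()
    renaming (_≈_ to _≈ₘ_; trans to transₘ; sym to symₘ; ∙-congˡ to ∙-congˡₘ)
  open Monoid (H₀ (suc n)) using () renaming (_≈_ to _≈ₕ_)

  act-H₀ : ∀ {is js} → is ≈ₕ js → ∀ x → act is x ≡ act js x
  act-H₀ (base refl)          x = refl
  act-H₀ (rel (idem i))       x = merge-idem (toℕ i) x
  act-H₀ (rel (comm i j 2≤))  x with far⇒apart (toℕ i) (toℕ j) 2≤
  ... | inj₁ i+1<j = merge-comm i+1<j x
  ... | inj₂ j+1<i = sym (merge-comm j+1<i x)
  act-H₀ (rel (braid i j j≡)) x rewrite j≡ =
    trans (merge-absorbˡ (toℕ i) x) (sym (merge-absorbʳ (toℕ i) x))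
  act-H₀ (symm p)             x = sym (act-H₀ p x)
  act-H₀ (transi p q)         x = trans (act-H₀ p x) (act-H₀ q x)
  act-H₀ (∙-congr {is} {is′} {js} {js′} p q) x =
    trans (act-++ is js x) (trans (cong (act is) (act-H₀ q x))
      (trans (act-H₀ p _) (sym (act-++ is′ js′ x))))

  act-M : ∀ {is js} → is ≈ₘ js → ∀ x → act is x ≡ act js x
  act-M (base p)              x = act-H₀ p x
  act-M (rel (absorb i j j≡)) x rewrite j≡ = merge-absorbˡ (toℕ i) x
  act-M (symm p)              x = sym (act-M p x)
  act-M (transi p q)          x = trans (act-M p x) (act-M q x)
  act-M (∙-congr {is} {is′} {js} {js′} p q) x =
    trans (act-++ is js x) (trans (cong (act is) (act-M q x))
      (trans (act-M p _) (sym (act-++ is′ js′ x))))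

  -- Out-of-range letters are trivial, so that the relations hold for all indices.
  letter : ℕ → List (Fin n)
  letter i with i <? n
  ... | yes i<n = fromℕ< i<n ∷ []
  ... | no _    = []

  letter-toℕ : ∀ i → letter (toℕ i) ≡ i ∷ []
  letter-toℕ i with toℕ i <? n
  ... | yes i<n = cong (_∷ []) (Fin.fromℕ<-toℕ i i<n)
  ... | no i≮n  = contradiction (Fin.toℕ<n i) i≮n

  letter-idem : ∀ i → letter i ++ letter i ≈ₘ letter i
  letter-idem i with i <? n
  ... | yes i<n = base (rel (idem _))
  ... | no _    = base (base refl)

  letter-comm : ∀ {i j} → suc i < j → letter i ++ letter j ≈ₘ letter j ++ letter i
  letter-comm {i} {j} i+1<j with i <? n | j <? n
  ... | yes i<n | yes j<n = base (rel (comm _ _ (subst₂ (λ a b → 2 ≤ ∣ a - b ∣)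
                              (sym (Fin.toℕ-fromℕ< i<n)) (sym (Fin.toℕ-fromℕ< j<n)) (apart⇒far i+1<j))))
  ... | yes _   | no _    = base (base refl)
  ... | no _    | yes _   = base (base refl)
  ... | no _    | no _    = base (base refl)

  toℕ-fromℕ<-suc : ∀ {i} (i<n : i < n) (i+1<n : suc i < n) →
                   toℕ (fromℕ< i+1<n) ≡ suc (toℕ (fromℕ< i<n))
  toℕ-fromℕ<-suc i<n i+1<n = trans (Fin.toℕ-fromℕ< i+1<n) (cong suc (sym (Fin.toℕ-fromℕ< i<n)))

  letter-absorbˡ : ∀ i → letter i ++ (letter (suc i) ++ letter i) ≈ₘ letter i ++ letter (suc i)
  letter-absorbˡ i with i <? n | suc i <? n
  ... | yes i<n | yes i+1<n = rel (absorb _ _ (toℕ-fromℕ<-suc i<n i+1<n))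
  -- At the last generator `letter (suc i)` is empty and the relation degenerates to idempotence.
  ... | yes _   | no _      = base (rel (idem _))
  ... | no _    | no _      = base (base refl)
  ... | no i≮n  | yes i+1<n = contradiction (<-trans ≤-refl i+1<n) i≮n

  -- The braid relation turns the left side into that of `letter-absorbˡ`.
  letter-absorbʳ : ∀ i → letter (suc i) ++ (letter i ++ letter (suc i)) ≈ₘ letter i ++ letter (suc i)
  letter-absorbʳ i with i <? n | suc i <? n
  ... | yes i<n | yes i+1<n = transₘ
    (symm (base (rel (braid _ _ (toℕ-fromℕ<-suc i<n i+1<n)))))
    (rel (absorb _ _ (toℕ-fromℕ<-suc i<n i+1<n)))
  ... | yes _   | no _      = base (base refl)
  ... | no _    | no _      = base (base refl)
  ... | no i≮n  | yes i+1<n = contradiction (<-trans ≤-refl i+1<n) i≮n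

  open NormalForm.Merging (M (suc n)) letter letter-idem letter-comm letter-absorbˡ letter-absorbʳ

  normal : (ℕ → ℕ) → List (Fin n)
  normal f = nf f (suc n)

  ≈ₘ-normal : ∀ is → is ≈ₘ normal (act is)
  ≈ₘ-normal []       = symₘ (nf-id (suc n))
  ≈ₘ-normal (i ∷ is) = transₘ (∙-congˡₘ {x = i ∷ []} (≈ₘ-normal is))
    (subst (λ l → l ++ normal (act is) ≈ₘ normal (act (i ∷ is))) (letter-toℕ i)
      (nf-merge (act-mono is) (act-≤ is) (suc n) (s≤s (Fin.toℕ<n i))))

  -- Each word equals the normal form of its action, and `normal` reads only the values at points
  -- below N = n + 1.
  act-injective : ∀ is js → (∀ x → x < suc n → act is x ≡ act js x) → is ≈ₘ js
  act-injective is js is≗js = transₘ (≈ₘ-normal is)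
    (transₘ (subst (normal (act is) ≈ₘ_)
        (nf-cong (suc n) is≗js)
        (Monoid.refl (M (suc n))))
      (symₘ (≈ₘ-normal js)))

-- Transpositions and the exchange property

private variable
  n N : ℕ

perm-injective : ∀ (w : Permutation′ N) {a b} → w ⟨$⟩ʳ a ≡ w ⟨$⟩ʳ b → a ≡ b
perm-injective w eq = trans (sym (inverseˡ w)) (trans (cong (w ⟨$⟩ˡ_) eq) (inverseˡ w))

transpose-left : ∀ (a b : Fin N) → transpose a b ⟨$⟩ʳ a ≡ b
transpose-left a b rewrite dec-true (a Fin.≟ a) refl = refl

transpose-other : ∀ {a b k : Fin N} → k ≢ a → k ≢ b → transpose a b ⟨$⟩ʳ k ≡ k
transpose-other {a = a} {b} {k} k≢a k≢b
  rewrite dec-false (k Fin.≟ a) k≢a | dec-false (k Fin.≟ b) k≢b = refl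

transpose-right : ∀ (a b : Fin N) → transpose a b ⟨$⟩ʳ b ≡ a
transpose-right a b with b Fin.≟ a
... | yes refl = refl
... | no b≢a rewrite dec-true (b Fin.≟ b) refl = refl

data Locate {N} (a b k : Fin N) : Set where
  at-left   : k ≡ a → Locate a b k
  at-right  : k ≡ b → Locate a b k
  elsewhere : k ≢ a → k ≢ b → Locate a b k

locate : ∀ (a b k : Fin N) → Locate a b k
locate a b k with k Fin.≟ a | k Fin.≟ b
... | yes k≡a | _       = at-left k≡a
... | no _    | yes k≡b = at-right k≡b
... | no k≢a  | no k≢b  = elsewhere k≢a k≢b

transpose-conj : ∀ (w : Permutation′ N) a b k →
                 w ⟨$⟩ʳ (transpose a b ⟨$⟩ʳ k) ≡
                 transpose (w ⟨$⟩ʳ a) (w ⟨$⟩ʳ b) ⟨$⟩ʳ (w ⟨$⟩ʳ k)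
transpose-conj w a b k with locate a b k
... | at-left refl = trans (cong (w ⟨$⟩ʳ_) (transpose-left a b))
  (sym (transpose-left (w ⟨$⟩ʳ a) (w ⟨$⟩ʳ b)))
... | at-right refl = trans (cong (w ⟨$⟩ʳ_) (transpose-right a b))
  (sym (transpose-right (w ⟨$⟩ʳ a) (w ⟨$⟩ʳ b)))
... | elsewhere k≢a k≢b = trans (cong (w ⟨$⟩ʳ_) (transpose-other k≢a k≢b))
  (sym (transpose-other (λ eq → k≢a (perm-injective w eq)) (λ eq → k≢b (perm-injective w eq))))

transpose-comm : ∀ (a b k : Fin N) → transpose a b ⟨$⟩ʳ k ≡ transpose b a ⟨$⟩ʳ k
transpose-comm a b k with locate a b k
... | at-left refl = trans (transpose-left a b) (sym (transpose-right b a))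
... | at-right refl = trans (transpose-right a b) (sym (transpose-left b a))
... | elsewhere k≢a k≢b = trans (transpose-other k≢a k≢b) (sym (transpose-other k≢b k≢a))

transpose-involutive : ∀ (a b k : Fin N) → transpose a b ⟨$⟩ʳ (transpose a b ⟨$⟩ʳ k) ≡ k
transpose-involutive a b k =
  -- The inverse of `transpose a b` is `transpose b a` by definition, hence the change of order.
  trans (transpose-comm a b (transpose a b ⟨$⟩ʳ k)) (inverseˡ (transpose a b) {k})

-- The graph of s_i on underlying numbers, for case distinctions without `Fin` arithmetic.
data Swapped (i : ℕ) : ℕ → ℕ → Set where
  lower : Swapped i i (suc i)
  upper : Swapped i (suc i) i
  other : ∀ {x} → x ≢ i → x ≢ suc i → Swapped i x x

s-swapped : ∀ (i : Fin n) (x : Fin (suc n)) → Swapped (toℕ i) (toℕ x) (toℕ (s {suc n} i ⟨$⟩ʳ x))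
s-swapped i x with locate (inject₁ i) (suc i) x
... | at-left refl rewrite transpose-left (inject₁ i) (suc i) | Fin.toℕ-inject₁ i = lower
... | at-right refl rewrite transpose-right (inject₁ i) (suc i) | Fin.toℕ-inject₁ i = upper
... | elsewhere x≢i x≢i+1 rewrite transpose-other x≢i x≢i+1 =
  other (λ eq → x≢i (Fin.toℕ-injective (trans eq (sym (Fin.toℕ-inject₁ i)))))
        (λ eq → x≢i+1 (Fin.toℕ-injective eq))

-- No number lies strictly between i and i + 1, so s_i can reverse no other pair. This locates the
-- letter that `exchange` deletes.
swapped-crossing : ∀ {i x x′ y y′} → Swapped i x x′ → Swapped i y y′ →
                   x < y → y′ < x′ → x ≡ i × y ≡ suc i
swapped-crossing lower         lower         x<y y′<x′ = contradiction x<y (<-irrefl refl)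
swapped-crossing lower         upper         x<y y′<x′ = refl , refl
swapped-crossing lower         (other y≢ _)  x<y y′<x′ =
  contradiction (≤-antisym (m<1+n⇒m≤n y′<x′) (<⇒≤ x<y)) y≢
swapped-crossing upper         lower         x<y y′<x′ = contradiction (<-trans x<y ≤-refl) (<-irrefl refl)
swapped-crossing upper         upper         x<y y′<x′ = contradiction x<y (<-irrefl refl)
swapped-crossing upper         (other _ _)   x<y y′<x′ =
  contradiction (<-trans ≤-refl (<-trans x<y y′<x′)) (<-irrefl refl)
swapped-crossing (other _ _)   lower         x<y y′<x′ =
  contradiction (<-trans x<y (<-trans ≤-refl y′<x′)) (<-irrefl refl)
swapped-crossing (other x≢ _)  upper         x<y y′<x′ =
  contradiction (≤-antisym (m<1+n⇒m≤n x<y) (<⇒≤ y′<x′)) x≢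
swapped-crossing (other _ _)   (other _ _)   x<y y′<x′ = contradiction (<-trans x<y y′<x′) (<-irrefl refl)

-- The strong exchange property. Letters act from the right end of the word, and the images of a < b
-- start in order and end reversed, so some letter reverses them; that letter is deleted.
exchange : ∀ (is : List (Fin n)) {a b} → a Fin.< b →
           (eval {suc n} is ⟨$⟩ʳ b) Fin.< (eval {suc n} is ⟨$⟩ʳ a) →
           ∃[ js ] length is ≡ suc (length js) × eval {suc n} js ≈ eval {suc n} is · transpose a b
exchange         []       a<b b<a = contradiction (<-trans a<b b<a) (<-irrefl refl)
exchange {n = n} (i ∷ is) {a} {b} a<b inv
  with Fin.<-cmp (eval {suc n} is ⟨$⟩ʳ a) (eval {suc n} is ⟨$⟩ʳ b)
... | tri≈ _ eq _ = contradiction inv (<-irrefl (cong (λ x → toℕ (s {suc n} i ⟨$⟩ʳ x)) (sym eq)))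
... | tri> _ _ pb<pa with exchange is a<b pb<pa
...   | js , len≡ , js≈ = i ∷ js , cong suc len≡ , λ k → cong (s {suc n} i ⟨$⟩ʳ_) (js≈ k)
exchange {n = n} (i ∷ is) {a} {b} a<b inv | tri< pa<pb _ _
  with swapped-crossing (s-swapped i _) (s-swapped i _) pa<pb inv
-- With p = `eval is`, s_i p (a b) = s_i (p(a) p(b)) p = s_i s_i p = p.
... | pa≡i , pb≡i+1 = is , refl , λ k → sym (trans
  (cong (s {suc n} i ⟨$⟩ʳ_) (trans (transpose-conj (eval is) a b k)
    (cong₂ (λ x y → transpose x y ⟨$⟩ʳ (eval is ⟨$⟩ʳ k))
      (Fin.toℕ-injective (trans pa≡i (sym (Fin.toℕ-inject₁ i))))
      (Fin.toℕ-injective pb≡i+1))))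
  (transpose-involutive (inject₁ i) (suc i) (eval is ⟨$⟩ʳ k)))

-- Length under transpositions

len-≤ : ∀ {x : Permutation′ N} js → eval js ≈ x → len x ≤ length js
len-≤ {x = x} js js≈x = proj₂ (reducedWord-isReduced x) js js≈x

len-cong : ∀ {x y : Permutation′ N} → x ≈ y → len x ≡ len y
len-cong {x = x} {y} x≈y = ≤-antisym
  (len-≤ (reducedWord y) λ k → trans (proj₁ (reducedWord-isReduced y) k) (sym (x≈y k)))
  (len-≤ (reducedWord x) λ k → trans (proj₁ (reducedWord-isReduced x) k) (x≈y k))

len-transpose : ∀ (w : Permutation′ (suc n)) {a b} → a Fin.< b → (w ⟨$⟩ʳ b) Fin.< (w ⟨$⟩ʳ a) →
                len (w · transpose a b) < len w
len-transpose w {a} {b} a<b wb<wa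
  with reducedWord-isReduced w
... | is≈w , _ with exchange (reducedWord w) a<b (subst₂ Fin._<_ (sym (is≈w b)) (sym (is≈w a)) wb<wa)
...   | js , len≡ , js≈ =
  ≤-trans (s≤s (len-≤ js λ k → trans (js≈ k) (is≈w _))) (≤-reflexive (sym len≡))

-- After the swap the pair is an inversion, and swapping again returns to w, so `len-transpose`
-- applies to the swapped permutation.
len-transpose-ascent : ∀ (w : Permutation′ (suc n)) {a b} → a Fin.< b → (w ⟨$⟩ʳ a) Fin.< (w ⟨$⟩ʳ b) →
                       len w < len (w · transpose a b)
len-transpose-ascent w {a} {b} a<b wa<wb =
  subst (_< len (w · transpose a b))
    (len-cong {x = (w · transpose a b) · transpose a b} {w}
      (λ k → cong (w ⟨$⟩ʳ_) (transpose-involutive a b k)))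
    (len-transpose (w · transpose a b) a<b
      (subst₂ Fin._<_ (cong (w ⟨$⟩ʳ_) (sym (transpose-right a b)))
                      (cong (w ⟨$⟩ʳ_) (sym (transpose-left a b))) wa<wb))

length-cycle : ∀ (k : Fin (suc n)) → length (cycle k) ≡ toℕ k
length-cycle         zero    = refl
length-cycle {suc n} (suc k) = trans (length-++ (map suc (cycle k)))
  (trans (+-comm _ 1) (cong suc (trans (length-map suc (cycle k)) (length-cycle k))))

length-word : ∀ (x : Permutation′ N) → length (proj₁ (word x)) ≤ N * N
length-word {zero}        x = z≤n
length-word {suc zero}    x = z≤n
length-word {suc (suc n)} x = begin
  length (cycle c ++ map suc js)    ≡⟨ length-++ (cycle c) ⟩
  length (cycle c) + length (map suc js)
    ≡⟨ cong₂ _+_ (length-cycle c) (length-map suc js) ⟩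
  toℕ c + length js                 ≤⟨ +-mono-≤ (<⇒≤ (Fin.toℕ<n c)) (length-word y) ⟩
  suc (suc n) + suc n * suc n       ≤⟨ +-monoʳ-≤ (suc (suc n)) (*-monoʳ-≤ (suc n) (n≤1+n (suc n))) ⟩
  suc (suc n) * suc (suc n)         ∎
  where
  open ≤-Reasoning
  c  = x ⟨$⟩ʳ 0F
  y  = remove 0F (flip (eval {suc (suc n)} (cycle c)) · x)
  js = proj₁ (word y)

-- A bound uniform in x lets the search for longest elements run as a descent; see `colen`.
len-bound : ∀ (x : Permutation′ N) → len x ≤ N * N
len-bound x = ≤-trans (len-≤ (proj₁ (word x)) (proj₂ (word x))) (length-word x)

-- Suffix minima

-- Characterizes g(j) = min { w(k) : k ≥ j } by its two defining properties, so that no minimum is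
-- ever computed.
record SuffixMin {N} (g : ℕ → ℕ) (w : Permutation′ N) : Set where
  field
    attained : ∀ (j : Fin N) → ∃[ l ] j Fin.≤ l × toℕ (w ⟨$⟩ʳ l) ≡ g (toℕ j)
    bound    : ∀ {j k : Fin N} → j Fin.≤ k → g (toℕ j) ≤ toℕ (w ⟨$⟩ʳ k)

open SuffixMin

suffixMin-≤ : ∀ {f g} {w : Permutation′ N} → SuffixMin f w → SuffixMin g w →
              ∀ j → f (toℕ j) ≤ g (toℕ j)
suffixMin-≤ F G j with attained G j
... | l , j≤l , wl≡ = ≤-trans (bound F j≤l) (≤-reflexive wl≡)

suffixMin-unique : ∀ {f g} {w : Permutation′ N} → SuffixMin f w → SuffixMin g w →
                   ∀ j → f (toℕ j) ≡ g (toℕ j)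
suffixMin-unique F G j = ≤-antisym (suffixMin-≤ F G j) (suffixMin-≤ G F j)

suffixMin-cong : ∀ {g} {w v : Permutation′ N} → w ≈ v → SuffixMin g w → SuffixMin g v
suffixMin-cong w≈v G .attained j with attained G j
... | l , j≤l , wl≡ = l , j≤l , trans (cong toℕ (sym (w≈v l))) wl≡
suffixMin-cong {g = g} w≈v G .bound {j} {k} j≤k =
  subst (λ x → g (toℕ j) ≤ toℕ x) (w≈v k) (bound G j≤k)

suffixMin-ext : ∀ {f g} {w : Permutation′ N} → (∀ x → f x ≡ g x) → SuffixMin f w → SuffixMin g w
suffixMin-ext f≗g F .attained j with attained F j
... | l , j≤l , wl≡ = l , j≤l , trans wl≡ (f≗g (toℕ j))
suffixMin-ext f≗g F .bound {j} j≤k = ≤-trans (≤-reflexive (sym (f≗g (toℕ j)))) (bound F j≤k)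

swapped-≥ : ∀ {i y y′} z → Swapped i y y′ → z ≤ y → merge i z ≤ y′
swapped-≥     z lower       z≤y = ≤-trans (merge-≤ _ z) (m≤n⇒m≤1+n z≤y)
swapped-≥ {i} z upper       z≤y = ≤-trans (merge-mono i z≤y) (≤-reflexive (merge-suc i))
swapped-≥     z (other _ _) z≤y = ≤-trans (merge-≤ _ z) z≤y

-- Since i stands left of i + 1 in w, a suffix containing i also contains i + 1. After the swap its
-- minimum i is therefore still present, while a minimum i + 1 drops to i.
suffixMin-s : ∀ {g} (w : Permutation′ (suc n)) i →
              (w ⟨$⟩ˡ inject₁ i) Fin.< (w ⟨$⟩ˡ suc i) →
              SuffixMin g w → SuffixMin (merge (toℕ i) ∘ g) (s {suc n} i · w)
suffixMin-s {g = g} w i asc G .bound {j} {k} j≤k =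
  swapped-≥ (g (toℕ j)) (s-swapped i (w ⟨$⟩ʳ k)) (bound G j≤k)
suffixMin-s {n = n} {g} w i asc G .attained j with attained G j
... | l , j≤l , wl≡ = attained′ (g (toℕ j) ≟ suc (toℕ i)) (g (toℕ j) ≟ toℕ i)
  where
  attained′ : Dec (g (toℕ j) ≡ suc (toℕ i)) → Dec (g (toℕ j) ≡ toℕ i) →
             ∃[ l ] j Fin.≤ l × toℕ (s {suc n} i ⟨$⟩ʳ (w ⟨$⟩ʳ l)) ≡ merge (toℕ i) (g (toℕ j))
  attained′ (yes eq) _ = l , j≤l ,
    trans (cong toℕ (trans (cong (s {suc n} i ⟨$⟩ʳ_) (Fin.toℕ-injective {j = suc i} (trans wl≡ eq)))
                           (transpose-right (inject₁ i) (suc i))))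
      (trans (Fin.toℕ-inject₁ i) (sym (trans (cong (merge (toℕ i)) eq) (merge-suc (toℕ i)))))
  -- The minimum i is now attained where w has i + 1, further right and so still in the suffix.
  attained′ (no ne) (yes eq) = w ⟨$⟩ˡ suc i ,
    ≤-trans j≤l (<⇒≤ (subst (Fin._< (w ⟨$⟩ˡ suc i)) l≡ asc)) ,
    trans (cong toℕ (trans (cong (s {suc n} i ⟨$⟩ʳ_) (inverseʳ w)) (transpose-right (inject₁ i) (suc i))))
      (trans (Fin.toℕ-inject₁ i) (sym (trans (merge-≢ {toℕ i} {g (toℕ j)} ne) eq)))
    where
    l≡ : w ⟨$⟩ˡ inject₁ i ≡ l
    l≡ = trans (cong (w ⟨$⟩ˡ_) (Fin.toℕ-injective (trans (Fin.toℕ-inject₁ i) (sym (trans wl≡ eq)))))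
               (inverseˡ w)
  attained′ (no ne) (no ne′) = l , j≤l ,
    trans (cong toℕ (transpose-other
        (λ eq → ne′ (trans (sym wl≡) (trans (cong toℕ eq) (Fin.toℕ-inject₁ i))))
        (λ eq → ne (trans (sym wl≡) (cong toℕ eq)))))
      (trans wl≡ (sym (merge-≢ {toℕ i} {g (toℕ j)} ne)))

-- If i + 1 stood left of i, left multiplication by s_i would swap an inverted pair of positions,
-- and `exchange` would yield a word for the product shorter than `is`.
reduced⇒ascent : ∀ (i : Fin n) is →
                 (∀ js → eval {suc n} js ≈ eval {suc n} (i ∷ is) → suc (length is) ≤ length js) →
                 (eval {suc n} is ⟨$⟩ˡ inject₁ i) Fin.< (eval {suc n} is ⟨$⟩ˡ suc i)
reduced⇒ascent {n} i is red with Fin.<-cmp (eval {suc n} is ⟨$⟩ˡ inject₁ i) (eval {suc n} is ⟨$⟩ˡ suc i)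
... | tri< asc _ _ = asc
... | tri≈ _ eq _ = contradiction
  (trans (sym (Fin.toℕ-inject₁ i))
    (cong toℕ (trans (sym (inverseʳ p)) (trans (cong (p ⟨$⟩ʳ_) eq) (inverseʳ p)))))
  (<⇒≢ ≤-refl)
  where p = eval {suc n} is
... | tri> _ _ desc with exchange is desc
      (subst₂ Fin._<_ (sym (inverseʳ (eval {suc n} is))) (sym (inverseʳ (eval {suc n} is)))
        (s≤s (≤-reflexive (Fin.toℕ-inject₁ i))))
...   | js , len≡ , js≈ = contradiction
  (≤-trans (m≤n⇒m≤1+n (red js λ k → trans (js≈ k)
    (trans (transpose-conj p (p ⟨$⟩ˡ suc i) (p ⟨$⟩ˡ inject₁ i) k)
    (trans (cong₂ (λ x y → transpose x y ⟨$⟩ʳ (p ⟨$⟩ʳ k)) (inverseʳ p) (inverseʳ p))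
           (transpose-comm (suc i) (inject₁ i) (p ⟨$⟩ʳ k))))))
    (≤-reflexive (sym len≡)))
  (<-irrefl refl)
  where p = eval {suc n} is

-- Minimality is assumed of the word itself because it passes to tails: a shorter word for the tail
-- would shorten the whole.
suffixMin-eval : ∀ (is : List (Fin n)) →
                 (∀ js → eval {suc n} js ≈ eval {suc n} is → length is ≤ length js) →
                 SuffixMin (act is) (eval {suc n} is)
suffixMin-eval []       red = record { attained = λ j → j , ≤-refl , refl ; bound = λ j≤k → j≤k }
suffixMin-eval {n} (i ∷ is) red = suffixMin-s (eval {suc n} is) i (reduced⇒ascent i is red)
  (suffixMin-eval is λ js js≈ → ≤-pred (red (i ∷ js) λ k → cong (s {suc n} i ⟨$⟩ʳ_) (js≈ k)))

suffixMin-reducedWord : ∀ (w : Permutation′ (suc n)) → SuffixMin (act (reducedWord w)) w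
suffixMin-reducedWord w with reducedWord-isReduced w
... | is≈w , red = suffixMin-cong is≈w
  (suffixMin-eval (reducedWord w) λ js js≈ → red js λ k → trans (js≈ k) (is≈w k))

-- Fibers as classes of equal suffix minima

fiber⇒suffixMin : ∀ {m} (w : Permutation′ (suc n)) → Fiber (suc n) m w → SuffixMin (act m) w
fiber⇒suffixMin w w∈F = suffixMin-ext (act-M w∈F) (suffixMin-reducedWord w)

suffixMin⇒fiber : ∀ {m} (w : Permutation′ (suc n)) → SuffixMin (act m) w → Fiber (suc n) m w
suffixMin⇒fiber {m = m} w G = act-injective (reducedWord w) m λ x x<N →
  subst (λ y → act (reducedWord w) y ≡ act m y) (Fin.toℕ-fromℕ< x<N)
    (suffixMin-unique (suffixMin-reducedWord w) G (fromℕ< x<N))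

-- The entry at c is smaller than those at a and b and lies to their right, so neither of these is
-- ever a suffix minimum.
suffixMin-transpose : ∀ {g} {w : Permutation′ N} {a b c} → a Fin.< b → b Fin.< c →
                      (w ⟨$⟩ʳ c) Fin.< (w ⟨$⟩ʳ a) → (w ⟨$⟩ʳ c) Fin.< (w ⟨$⟩ʳ b) →
                      SuffixMin g w → SuffixMin g (w · transpose a b)
suffixMin-transpose {g = g} {w} {a} {b} {c} a<b b<c wc<wa wc<wb G .attained j with attained G j
... | l , j≤l , wl≡ with locate a b l
...   | at-left refl = contradiction
  (<-≤-trans wc<wa (≤-trans (≤-reflexive wl≡) (bound G (≤-trans j≤l (<⇒≤ (<-trans a<b b<c))))))
  (<-irrefl refl)
...   | at-right refl = contradiction
  (<-≤-trans wc<wb (≤-trans (≤-reflexive wl≡) (bound G (≤-trans j≤l (<⇒≤ b<c)))))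
  (<-irrefl refl)
...   | elsewhere l≢a l≢b = l , j≤l ,
  trans (cong (λ x → toℕ (w ⟨$⟩ʳ x)) (transpose-other l≢a l≢b)) wl≡
suffixMin-transpose {g = g} {w} {a} {b} {c} a<b b<c wc<wa wc<wb G .bound {j} {k} j≤k with locate a b k
... | at-left refl = subst (λ x → g (toℕ j) ≤ toℕ (w ⟨$⟩ʳ x)) (sym (transpose-left a b))
  (bound G (≤-trans j≤k (<⇒≤ a<b)))
-- The entry w(a) now at b may come from outside the suffix, so it is bounded through w(c) < w(a).
... | at-right refl = subst (λ x → g (toℕ j) ≤ toℕ (w ⟨$⟩ʳ x)) (sym (transpose-right a b))
  (≤-trans (bound G (≤-trans j≤k (<⇒≤ b<c))) (<⇒≤ wc<wa))
... | elsewhere k≢a k≢b = subst (λ x → g (toℕ j) ≤ toℕ (w ⟨$⟩ʳ x)) (sym (transpose-other k≢a k≢b))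
  (bound G j≤k)

-- Patterns

-- Quantifying over positions instead of embeddings makes containment decidable by finite search.
Has321 Has231 : Permutation′ N → Set
Has321 w = ∃[ a ] ∃[ b ] ∃[ c ] a Fin.< b × b Fin.< c ×
  (w ⟨$⟩ʳ b) Fin.< (w ⟨$⟩ʳ a) × (w ⟨$⟩ʳ c) Fin.< (w ⟨$⟩ʳ b)
Has231 w = ∃[ a ] ∃[ b ] ∃[ c ] a Fin.< b × b Fin.< c ×
  (w ⟨$⟩ʳ a) Fin.< (w ⟨$⟩ʳ b) × (w ⟨$⟩ʳ c) Fin.< (w ⟨$⟩ʳ a)

has321? : Decidable (Has321 {N})
has321? w = Fin.any? λ a → Fin.any? λ b → Fin.any? λ c →
  a Fin.<? b ×-dec b Fin.<? c ×-dec (w ⟨$⟩ʳ b) Fin.<? (w ⟨$⟩ʳ a) ×-dec (w ⟨$⟩ʳ c) Fin.<? (w ⟨$⟩ʳ b)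

has231? : Decidable (Has231 {N})
has231? w = Fin.any? λ a → Fin.any? λ b → Fin.any? λ c →
  a Fin.<? b ×-dec b Fin.<? c ×-dec (w ⟨$⟩ʳ a) Fin.<? (w ⟨$⟩ʳ b) ×-dec (w ⟨$⟩ʳ c) Fin.<? (w ⟨$⟩ʳ a)

-- One direction of the equivalence suffices: by trichotomy and injectivity of σ, a map that
-- preserves the order of the values also reflects it.
contains-intro : ∀ {k} {w : Permutation′ N} {σ : Permutation′ k} (p : Fin k → Fin N) →
                 (∀ a b → a Fin.< b → p a Fin.< p b) →
                 (∀ a b → (σ ⟨$⟩ʳ a) Fin.< (σ ⟨$⟩ʳ b) → (w ⟨$⟩ʳ p a) Fin.< (w ⟨$⟩ʳ p b)) →
                 Contains w σ
contains-intro {w = w} {σ} p mono σ⇒w = p , mono , λ a b → mk⇔ (w⇒σ a b) (σ⇒w a b)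
  where
  w⇒σ : ∀ a b → (w ⟨$⟩ʳ p a) Fin.< (w ⟨$⟩ʳ p b) → (σ ⟨$⟩ʳ a) Fin.< (σ ⟨$⟩ʳ b)
  w⇒σ a b wa<wb with Fin.<-cmp (σ ⟨$⟩ʳ a) (σ ⟨$⟩ʳ b)
  ... | tri< σa<σb _ _ = σa<σb
  ... | tri≈ _ σa≡σb _ =
    contradiction wa<wb (<-irrefl (cong (λ x → toℕ (w ⟨$⟩ʳ p x)) (perm-injective σ σa≡σb)))
  ... | tri> _ _ σb<σa = contradiction (<-trans wa<wb (σ⇒w b a σb<σa)) (<-irrefl refl)

triple : (a b c : Fin N) → Fin 3 → Fin N
triple a b c 0F = a
triple a b c 1F = b
triple a b c 2F = c

triple-mono : ∀ {a b c : Fin N} → a Fin.< b → b Fin.< c →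
              ∀ i j → i Fin.< j → triple a b c i Fin.< triple a b c j
triple-mono a<b b<c 0F 1F _ = a<b
triple-mono a<b b<c 0F 2F _ = <-trans a<b b<c
triple-mono a<b b<c 1F 2F _ = b<c
triple-mono a<b b<c 1F 1F (s≤s ())
triple-mono a<b b<c 2F 1F (s≤s ())
triple-mono a<b b<c 2F 2F (s≤s (s≤s ()))

has321⇒contains : ∀ {w : Permutation′ N} → Has321 w → Contains w [321]
has321⇒contains {w = w} (a , b , c , a<b , b<c , wb<wa , wc<wb) =
  contains-intro {w = w} {[321]} (triple a b c) (triple-mono a<b b<c) order
  where
  order : ∀ i j → ([321] ⟨$⟩ʳ i) Fin.< ([321] ⟨$⟩ʳ j) →
          (w ⟨$⟩ʳ triple a b c i) Fin.< (w ⟨$⟩ʳ triple a b c j)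
  order 0F 0F (s≤s (s≤s ()))
  order 0F 1F (s≤s ())
  order 1F 0F _ = wb<wa
  order 1F 1F (s≤s ())
  order 2F 0F _ = <-trans wc<wb wb<wa
  order 2F 1F _ = wc<wb
  order _  2F ()

has231⇒contains : ∀ {w : Permutation′ N} → Has231 w → Contains w [231]
has231⇒contains {w = w} (a , b , c , a<b , b<c , wa<wb , wc<wa) =
  contains-intro {w = w} {[231]} (triple a b c) (triple-mono a<b b<c) order
  where
  order : ∀ i j → ([231] ⟨$⟩ʳ i) Fin.< ([231] ⟨$⟩ʳ j) →
          (w ⟨$⟩ʳ triple a b c i) Fin.< (w ⟨$⟩ʳ triple a b c j)
  order 0F 0F (s≤s ())
  order 0F 1F _ = wa<wb
  order 1F 0F (s≤s ())
  order 1F 1F (s≤s (s≤s ()))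
  order 2F 0F _ = wc<wa
  order 2F 1F _ = <-trans wc<wa wa<wb
  order _  2F ()

contains⇒has321 : ∀ {w : Permutation′ N} → Contains w [321] → Has321 w
contains⇒has321 (p , mono , order) = p 0F , p 1F , p 2F ,
  mono 0F 1F (s≤s z≤n) , mono 1F 2F (s≤s (s≤s z≤n)) ,
  Equivalence.from (order 1F 0F) (s≤s (s≤s z≤n)) , Equivalence.from (order 2F 1F) (s≤s z≤n)

contains⇒has231 : ∀ {w : Permutation′ N} → Contains w [231] → Has231 w
contains⇒has231 (p , mono , order) = p 0F , p 1F , p 2F ,
  mono 0F 1F (s≤s z≤n) , mono 1F 2F (s≤s (s≤s z≤n)) ,
  Equivalence.from (order 0F 1F) (s≤s (s≤s z≤n)) , Equivalence.from (order 2F 0F) (s≤s z≤n)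

-- The value w(j) occurs in v at some k, and k > j because w and v agree before j. Either v(k) is no
-- suffix minimum, which gives a 321 pattern in v, or w must take this value twice.
prefix-≮ : ∀ {g} {w v : Permutation′ N} → ¬ Has321 v → SuffixMin g w → SuffixMin g v →
           ∀ j → (∀ {k} → k Fin.< j → w ⟨$⟩ʳ k ≡ v ⟨$⟩ʳ k) → ¬ (w ⟨$⟩ʳ j) Fin.< (v ⟨$⟩ʳ j)
prefix-≮ {g = g} {w} {v} v-avoids W V j agree wj<vj = absurd (m≤n⇒m<n∨m≡n g≤vk)
  where
  k = v ⟨$⟩ˡ (w ⟨$⟩ʳ j)

  vk≡wj : v ⟨$⟩ʳ k ≡ w ⟨$⟩ʳ j
  vk≡wj = inverseʳ v

  j<k : j Fin.< k
  j<k with Fin.<-cmp j k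
  ... | tri< j<k _ _ = j<k
  ... | tri≈ _ j≡k _ = contradiction wj<vj
    (<-irrefl (cong toℕ (trans (sym vk≡wj) (cong (v ⟨$⟩ʳ_) (sym j≡k)))))
  ... | tri> _ _ k<j = contradiction k<j
    (<-irrefl (cong toℕ (perm-injective w (trans (agree k<j) vk≡wj))))

  g≤vk : g (toℕ k) ≤ toℕ (v ⟨$⟩ʳ k)
  g≤vk = bound V ≤-refl

  absurd : ¬ (g (toℕ k) < toℕ (v ⟨$⟩ʳ k) ⊎ g (toℕ k) ≡ toℕ (v ⟨$⟩ʳ k))
  -- The suffix minimum v(k) = w(j) is attained by w at some l ≥ k > j, against injectivity.
  absurd (inj₂ g≡vk) with attained W k
  ... | l , k≤l , wl≡ = contradiction (<-≤-trans j<k k≤l)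
    (<-irrefl (cong toℕ (perm-injective w (sym (trans (Fin.toℕ-injective (trans wl≡ g≡vk)) vk≡wj)))))
  -- Some l > k has v(l) < v(k) = w(j) < v(j), so j < k < l is a 321 pattern.
  absurd (inj₁ g<vk) with attained V k
  ... | l , k≤l , vl≡ = v-avoids (j , k , l , j<k ,
    ≤∧≢⇒< k≤l (λ k≡l → <⇒≢ vl<vk (cong (λ x → toℕ (v ⟨$⟩ʳ x)) (Fin.toℕ-injective (sym k≡l)))) ,
    subst (Fin._< (v ⟨$⟩ʳ j)) (sym vk≡wj) wj<vj , vl<vk)
    where
    vl<vk : (v ⟨$⟩ʳ l) Fin.< (v ⟨$⟩ʳ k)
    vl<vk = subst (_< toℕ (v ⟨$⟩ʳ k)) (sym vl≡) g<vk

-- The value w(j) occurs in v at some k < j because w and v agree after j. The common suffix minimum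
-- at j is at most w(j), so v attains it at some l > j, and k < j < l is a 231 pattern in v.
suffix-≮ : ∀ {g} {w v : Permutation′ N} → ¬ Has231 v → SuffixMin g w → SuffixMin g v →
           ∀ j → (∀ {k} → k Fin.> j → w ⟨$⟩ʳ k ≡ v ⟨$⟩ʳ k) → ¬ (w ⟨$⟩ʳ j) Fin.< (v ⟨$⟩ʳ j)
suffix-≮ {g = g} {w} {v} v-avoids W V j agree wj<vj with attained V j
... | l , j≤l , vl≡ = v-avoids
  (k , j , l , k<j , j<l , subst (Fin._< (v ⟨$⟩ʳ j)) (sym vk≡wj) wj<vj , vl<vk)
  where
  k = v ⟨$⟩ˡ (w ⟨$⟩ʳ j)

  vk≡wj : v ⟨$⟩ʳ k ≡ w ⟨$⟩ʳ j
  vk≡wj = inverseʳ v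

  k<j : k Fin.< j
  k<j with Fin.<-cmp k j
  ... | tri< k<j _ _ = k<j
  ... | tri≈ _ k≡j _ = contradiction wj<vj
    (<-irrefl (cong toℕ (trans (sym vk≡wj) (cong (v ⟨$⟩ʳ_) k≡j))))
  ... | tri> _ _ j<k = contradiction j<k
    (<-irrefl (cong toℕ (perm-injective w (sym (trans (agree j<k) vk≡wj)))))

  vl≤wj : toℕ (v ⟨$⟩ʳ l) ≤ toℕ (w ⟨$⟩ʳ j)
  vl≤wj = ≤-trans (≤-reflexive vl≡) (bound W ≤-refl)

  j<l : j Fin.< l
  j<l = ≤∧≢⇒< j≤l λ j≡l → contradiction (≤-<-trans vl≤wj wj<vj)
    (<-irrefl (cong (λ x → toℕ (v ⟨$⟩ʳ x)) (Fin.toℕ-injective (sym j≡l))))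

  vl<vk : (v ⟨$⟩ʳ l) Fin.< (v ⟨$⟩ʳ k)
  vl<vk = ≤∧≢⇒< (≤-trans vl≤wj (≤-reflexive (cong toℕ (sym vk≡wj)))) λ vl≡vk →
    <⇒≢ (<-trans k<j j<l) (cong toℕ (perm-injective v (Fin.toℕ-injective (sym vl≡vk))))

≮∧≯⇒≡ : ∀ {x y : Fin N} → ¬ x Fin.< y → ¬ y Fin.< x → x ≡ y
≮∧≯⇒≡ {x = x} {y} x≮y y≮x with Fin.<-cmp x y
... | tri< x<y _ _ = contradiction x<y x≮y
... | tri≈ _ x≡y _ = x≡y
... | tri> _ _ y<x = contradiction y<x y≮x

321-avoiding-unique : ∀ {g} {w v : Permutation′ N} → SuffixMin g w → SuffixMin g v →
                      ¬ Has321 w → ¬ Has321 v → w ≈ v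
321-avoiding-unique {w = w} {v} W V ¬w ¬v j = go j (Fin.<-wellFounded j)
  where
  go : ∀ j → Acc Fin._<_ j → w ⟨$⟩ʳ j ≡ v ⟨$⟩ʳ j
  go j (acc rs) = ≮∧≯⇒≡ (prefix-≮ ¬v W V j λ k<j → go _ (rs k<j))
                        (prefix-≮ ¬w V W j λ k<j → sym (go _ (rs k<j)))

231-avoiding-unique : ∀ {g} {w v : Permutation′ N} → SuffixMin g w → SuffixMin g v →
                      ¬ Has231 w → ¬ Has231 v → w ≈ v
231-avoiding-unique {w = w} {v} W V ¬w ¬v j = go j (Fin.>-wellFounded j)
  where
  go : ∀ j → Acc Fin._>_ j → w ⟨$⟩ʳ j ≡ v ⟨$⟩ʳ j
  go j (acc rs) = ≮∧≯⇒≡ (suffix-≮ ¬v W V j λ k>j → go _ (rs k>j))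
                        (suffix-≮ ¬w V W j λ k>j → sym (go _ (rs k>j)))

-- Extremal elements of the fibers

module Descent {F P : Pred (Permutation′ N) 0ℓ} (P? : Decidable P)
  (μ : Permutation′ N → ℕ) (μ-cong : ∀ {w v} → w ≈ v → μ w ≡ μ v)
  (step : ∀ {w} → F w → P w → ∃[ v ] F v × μ v < μ w)
  (unique : ∀ {w v} → F w → F v → ¬ P w → ¬ P v → w ≈ v)
  where

  descend : ∀ w → Acc _<_ (μ w) → F w → ∃[ v ] F v × ¬ P v × μ v ≤ μ w
  descend w (acc rs) w∈F with P? w
  ... | no ¬Pw = w , w∈F , ¬Pw , ≤-refl
  ... | yes Pw with step w∈F Pw
  ...   | v , v∈F , μv<μw with descend v (rs μv<μw) v∈F
  ...     | u , u∈F , ¬Pu , μu≤μv = u , u∈F , ¬Pu , ≤-trans μu≤μv (<⇒≤ μv<μw)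

  -- Descending from any v in F ends at an element without P, which `unique` identifies with w.
  minimal : ∀ w → F w → ¬ P w → ∀ v → F v → μ w ≤ μ v
  minimal w w∈F ¬Pw v v∈F with descend v (<-wellFounded _) v∈F
  ... | u , u∈F , ¬Pu , μu≤μv = ≤-trans (≤-reflexive (μ-cong (unique w∈F u∈F ¬Pw ¬Pu))) μu≤μv

  exists-unique : ∃ F → ∃! _≈_ (λ w → F w × ¬ P w)
  exists-unique (w , w∈F) with descend w (<-wellFounded _) w∈F
  ... | u , u∈F , ¬Pu , _ = u , (u∈F , ¬Pu) , λ (v∈F , ¬Pv) → unique u∈F v∈F ¬Pu ¬Pv

∃!-avoiding : ∀ {F P Q : Pred (Permutation′ N) 0ℓ} →
              (∀ {w} → Q w → P w) → (∀ {w} → P w → Q w) →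
              ∃! _≈_ (λ w → F w × ¬ P w) → ∃! _≈_ (λ w → F w × ¬ Q w)
∃!-avoiding Q⇒P P⇒Q (w , (w∈F , ¬Pw) , unique) =
  w , (w∈F , ¬Pw ∘ Q⇒P) , λ (v∈F , ¬Qv) → unique (v∈F , ¬Qv ∘ P⇒Q)

module _ {m : Monoid.Carrier (M (suc n))} where

  -- Leaves the order of w(a) and w(b) open, so as to serve both patterns.
  swap-in-fiber : ∀ {w a b c} → a Fin.< b → b Fin.< c →
                  (w ⟨$⟩ʳ c) Fin.< (w ⟨$⟩ʳ a) → (w ⟨$⟩ʳ c) Fin.< (w ⟨$⟩ʳ b) →
                  Fiber (suc n) m w → Fiber (suc n) m (w · transpose a b)
  swap-in-fiber {w} {a} {b} a<b b<c wc<wa wc<wb w∈F =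
    suffixMin⇒fiber {m = m} (w · transpose a b)
      (suffixMin-transpose a<b b<c wc<wa wc<wb (fiber⇒suffixMin {m = m} w w∈F))

  shorter-in-fiber : ∀ {w} → Fiber (suc n) m w → Has321 w →
                     ∃[ v ] Fiber (suc n) m v × len v < len w
  shorter-in-fiber {w} w∈F (a , b , c , a<b , b<c , wb<wa , wc<wb) =
    w · transpose a b ,
    swap-in-fiber {w} a<b b<c (<-trans wc<wb wb<wa) wc<wb w∈F ,
    len-transpose w a<b wb<wa

  longer-in-fiber : ∀ {w} → Fiber (suc n) m w → Has231 w →
                    ∃[ v ] Fiber (suc n) m v × len w < len v
  longer-in-fiber {w} w∈F (a , b , c , a<b , b<c , wa<wb , wc<wa) =
    w · transpose a b ,
    swap-in-fiber {w} a<b b<c wc<wa (<-trans wc<wa wa<wb) w∈F ,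
    len-transpose-ascent w a<b wa<wb

  -- Turns maximal length into minimal `colen`; by `len-bound` the subtraction is never truncated.
  colen : Permutation′ (suc n) → ℕ
  colen w = suc n * suc n ∸ len w

  smaller-colen-in-fiber : ∀ {w} → Fiber (suc n) m w → Has231 w →
                           ∃[ v ] Fiber (suc n) m v × colen v < colen w
  smaller-colen-in-fiber {w} w∈F has with longer-in-fiber {w} w∈F has
  ... | v , v∈F , w<v = v , v∈F , ∸-monoʳ-< w<v (len-bound v)

  module Shortest = Descent {F = Fiber (suc n) m} has321? len
    (λ {w} {v} → len-cong {x = w} {v})
    (λ {w} → shorter-in-fiber {w})
    (λ {w} {v} w∈F v∈F → 321-avoiding-unique
      (fiber⇒suffixMin {m = m} w w∈F) (fiber⇒suffixMin {m = m} v v∈F))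

  module Longest = Descent {F = Fiber (suc n) m} has231? colen
    (λ {w} {v} w≈v → cong (suc n * suc n ∸_) (len-cong {x = w} {v} w≈v))
    (λ {w} → smaller-colen-in-fiber {w})
    (λ {w} {v} w∈F v∈F → 231-avoiding-unique
      (fiber⇒suffixMin {m = m} w w∈F) (fiber⇒suffixMin {m = m} v v∈F))

mainTheorem1 : (N : ℕ) → N ≥ 1 →
    (m : Monoid.Carrier (M N)) → ∃ (Fiber N m) →
    (∃! _≈_ (λ w → Fiber N m w × Avoids w [321])
    × (∀ w → Fiber N m w → Avoids w [321] → ∀ v → Fiber N m v → len w ≤ len v))
    × (∃! _≈_ (λ w → Fiber N m w × Avoids w [231])
    × (∀ w → Fiber N m w → Avoids w [231] → ∀ v → Fiber N m v → len v ≤ len w))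
mainTheorem1 (suc n) _ m inhabited =
  (∃!-avoiding (λ {w} → contains⇒has321 {w = w}) (λ {w} → has321⇒contains {w = w})
     (Shortest.exists-unique inhabited) ,
   λ w w∈F avoids → Shortest.minimal w w∈F (avoids ∘ has321⇒contains {w = w})) ,
  (∃!-avoiding (λ {w} → contains⇒has231 {w = w}) (λ {w} → has231⇒contains {w = w})
     (Longest.exists-unique inhabited) ,
   λ w w∈F avoids v v∈F →
     -- As `len v` is at most N², comparing `colen` gives back the comparison of lengths, reversed.
     ∸-cancelʳ-≤ (len-bound v) (Longest.minimal w w∈F (avoids ∘ has231⇒contains {w = w}) v v∈F))
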